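{- For every $\theta\in[0,1]$, $f(\theta)=l(\theta)$.
   Context: A weighted digraph $D=(V,A,w)$ is a digraph without loops or parallel arcs (opposite arcs allowed) with weights $w:A\to\mathbb{R}_{\ge0}$; $w(D)$ is the total arc weight. For a partition $(X,Y)$ of $V$, $w(X,Y)$ is the total weight of arcs from $X$ to $Y$, and $\mathrm{mac}(D)=\max_{(X,Y)}w(X,Y)$. For $v\in V$, $r(v)=w^+(v)-w^-(v)$ (total weight leaving minus total weight entering $v$); $r^+(D)=\sum_{r(x)>0}r(x)$; $\theta(D)=r^+(D)/w(D)$ for $w(D)>0$. For $\theta\in[0,1]$, $f(\theta)$ is the supremum of all reals $g$ such that $\mathrm{mac}(D)\ge g\cdot w(D)$ for all weighted digraphs $D$ with $w(D)>0$ and $\theta(D)=\theta$. Also $l(\theta)=\frac14+\frac{\theta^2}{4(1-2\theta)}$ if $\theta<1/3$ and $l(\theta)=\theta$ if $\theta\ge1/3$. -}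

module Defs where

open import Level using (Level; suc) renaming (_⊔_ to _⊔ˡ_)
open import Algebra.Core using (Op₂)
open import Algebra.Bundles using (CommutativeRing)
open import Algebra.Apartness.Bundles using (HeytingField; HeytingCommutativeRing)
import Algebra.Apartness.Properties.HeytingCommutativeRing as HeytingProperties
import Algebra.Properties.CommutativeMonoid.Sum as Sum
import Algebra.Properties.Monoid.Mult as Mult
import Algebra.Properties.Ring as RingProperties
open import Data.Bool.Base using (if_then_else_; not; _∧_)
open import Data.Empty using (⊥-elim)
open import Data.Fin.Base using (Fin)
open import Data.Fin.Subset using (Subset; inside; outside)
open import Data.Maybe.Base using (Maybe; nothing; fromMaybe)
open import Data.Maybe.Relation.Unary.All using (All)
open import Data.Nat.Base as ℕ using (ℕ)
open import Data.Product.Base using (∃; _×_; _,_; proj₁; proj₂)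
open import Data.Sum.Base using (_⊎_; inj₁; inj₂)
open import Data.Vec.Base using ([]; _∷_; lookup)
open import Relation.Binary.Core using (Rel)
open import Relation.Binary.Lattice.Definitions using (Supremum)
open import Relation.Binary.PropositionalEquality.Core using (_≡_)
open import Relation.Binary.Structures using (IsStrictPartialOrder)
open import Relation.Nullary.Negation using (¬_)
open import Relation.Unary using (Pred)

-- The real numbers, axiomatised as a Cauchy-complete Archimedean ordered field.
-- Under excluded middle, ℝ is the only such structure up to isomorphism.  The
-- order is not assumed decidable, so that the axioms are also satisfied
-- constructively, by regular Cauchy sequences of rationals.
record RealNumbers (c ℓ₁ ℓ₂ : Level) : Set (suc (c ⊔ˡ ℓ₁ ⊔ˡ ℓ₂)) where
  infix  4 _<_ _≤_
  infixl 6 _⊔_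

  field
    heytingField : HeytingField c ℓ₁ ℓ₂

  open HeytingField heytingField public

  open CommutativeRing (HeytingCommutativeRing.commutativeRing heytingCommutativeRing) public
    using (ring; +-monoid; +-commutativeMonoid)

  fromℕ : ℕ → Carrier
  fromℕ n = Mult._×_ +-monoid n 1#

  field
    _<_                  : Rel Carrier ℓ₂
    isStrictPartialOrder : IsStrictPartialOrder _≈_ _<_
    <⇒#                  : ∀ {x y} → x < y → x # y
    #⇒<⊎>                : ∀ {x y} → x # y → x < y ⊎ y < x
    +-monoˡ-<            : ∀ z {x y} → x < y → x + z < y + z
    *-pos                : ∀ {x y} → 0# < x → 0# < y → 0# < x * y

  _≤_ : Rel Carrier ℓ₂
  x ≤ y = ¬ (y < x)

  field
    _⊔_         : Op₂ Carrier
    ⊔-supremum  : Supremum _≤_ _⊔_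
    archimedean : ∀ x → ∃ λ n → x < fromℕ n
    complete    : (s : ℕ → Carrier) →
                  (∀ ε → 0# < ε →
                     ∃ λ N → ∀ m n → N ℕ.≤ m → N ℕ.≤ n → s m - s n < ε) →
                  ∃ λ x → ∀ ε → 0# < ε →
                     ∃ λ N → ∀ n → N ℕ.≤ n → (s n - x < ε) × (x - s n < ε)

  module < = IsStrictPartialOrder isStrictPartialOrder

module Real {c ℓ₁ ℓ₂ : Level} (ℝ : RealNumbers c ℓ₁ ℓ₂) where

  open RealNumbers ℝ public
  open RingProperties ring
    using (-‿distribʳ-*; -‿involutive; -0#≈0#)
  open HeytingProperties heytingCommutativeRing using (1#0; x-0≈x; invertibleˡ⇒#)
  open Sum +-commutativeMonoid using (sum)

  private
    <-cong : ∀ {x x′ y y′} → x ≈ x′ → y ≈ y′ → x < y → x′ < y′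
    <-cong x≈x′ y≈y′ x<y = <.<-respˡ-≈ x≈x′ (<.<-respʳ-≈ y≈y′ x<y)

    x<y⇒0<y-x : ∀ {x y} → x < y → 0# < y - x
    x<y⇒0<y-x {x} x<y = <-cong (-‿inverseʳ x) refl (+-monoˡ-< (- x) x<y)

    x<0⇒0<-x : ∀ {x} → x < 0# → 0# < - x
    x<0⇒0<-x {x} x<0 = <-cong refl (+-identityˡ (- x)) (x<y⇒0<y-x x<0)

    +-mono-< : ∀ {x y u v} → x < y → u < v → x + u < y + v
    +-mono-< {x} {y} {u} {v} x<y u<v =
      <.trans (+-monoˡ-< u x<y) (<-cong (+-comm u y) (+-comm v y) (+-monoˡ-< y u<v))

    0<1 : 0# < 1#
    0<1 with #⇒<⊎> 1#0
    ... | inj₂ 0<1 = 0<1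
    ... | inj₁ 1<0 = <-cong refl -1*-1≈1 (*-pos (x<0⇒0<-x 1<0) (x<0⇒0<-x 1<0))
      where
      -1*-1≈1 : - 1# * - 1# ≈ 1#
      -1*-1≈1 = trans (sym (-‿distribʳ-* (- 1#) 1#))
                      (trans (-‿cong (*-identityʳ (- 1#))) (-‿involutive 1#))

  0<fromℕ : ∀ n → 0# < fromℕ (ℕ.suc n)
  0<fromℕ ℕ.zero    = <-cong refl (sym (+-identityʳ 1#)) 0<1
  0<fromℕ (ℕ.suc n) = <-cong (+-identityʳ 0#) refl (+-mono-< 0<1 (0<fromℕ n))

  recip : (x : Carrier) → 0# < x → Carrier
  recip x 0<x = proj₁ (#⇒invertible (#-sym (<⇒# 0<x)))

  recip-inverseʳ : ∀ x (0<x : 0# < x) → x * recip x 0<x ≈ 1#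
  recip-inverseʳ x 0<x =
    trans (*-congʳ (sym (x-0≈x x))) (proj₂ (proj₂ (#⇒invertible (#-sym (<⇒# 0<x)))))

  0<recip : ∀ x (0<x : 0# < x) → 0# < recip x 0<x
  0<recip x 0<x with #⇒<⊎> (invertibleˡ⇒# (x , trans (*-congˡ (x-0≈x _)) (recip-inverseʳ x 0<x)))
  ... | inj₂ 0<x⁻¹ = 0<x⁻¹
  ... | inj₁ x⁻¹<0 = ⊥-elim (<.irrefl refl (<-cong (+-identityʳ 0#) 1-1≈0 (+-mono-< 0<1 0<-1)))
    where
    0<-1 : 0# < - 1#
    0<-1 = <-cong refl (trans (sym (-‿distribʳ-* x _)) (-‿cong (recip-inverseʳ x 0<x)))
                  (*-pos 0<x (x<0⇒0<-x x⁻¹<0))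
    1-1≈0 : 1# - 1# ≈ 0#
    1-1≈0 = -‿inverseʳ 1#

  ⅓ ¼ : Carrier
  ⅓ = recip (fromℕ 3) (0<fromℕ 2)
  ¼ = recip (fromℕ 4) (0<fromℕ 3)

  -- The arcs are the pairs (u , v) on which `arc u v` is `just` a value, and that
  -- value is the weight of the arc.
  record WeightedDigraph (n : ℕ) : Set (c ⊔ˡ ℓ₂) where
    field
      arc         : Fin n → Fin n → Maybe Carrier
      loopless    : ∀ v → arc v v ≡ nothing
      nonNegative : ∀ u v → All (0# ≤_) (arc u v)

    arcWeight : Fin n → Fin n → Carrier
    arcWeight u v = fromMaybe 0# (arc u v)

    totalWeight : Carrier
    totalWeight = sum λ u → sum λ v → arcWeight u v

    -- The weight w(X , Y) of the arcs from X to its complement Y.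
    cutWeight : Subset n → Carrier
    cutWeight X = sum λ u → sum λ v →
      if lookup X u ∧ not (lookup X v) then arcWeight u v else 0#

    outWeight inWeight r : Fin n → Carrier
    outWeight v = sum λ u → arcWeight v u
    inWeight  v = sum λ u → arcWeight u v
    r v         = outWeight v - inWeight v

    -- As r v ⊔ 0 is r v when r v > 0 and is 0 otherwise, this is the sum of r v
    -- over the vertices with r v > 0.
    r⁺ : Carrier
    r⁺ = sum λ v → r v ⊔ 0#

    imbalance : 0# < totalWeight → Carrier
    imbalance 0<w = r⁺ * recip totalWeight 0<w

  maxOverSubsets : ∀ n → (Subset n → Carrier) → Carrier
  maxOverSubsets ℕ.zero    φ = φ []
  maxOverSubsets (ℕ.suc n) φ =
    maxOverSubsets n (λ X → φ (inside ∷ X)) ⊔ maxOverSubsets n (λ X → φ (outside ∷ X))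

  mac : ∀ {n} → WeightedDigraph n → Carrier
  mac {n} D = maxOverSubsets n (WeightedDigraph.cutWeight D)

  IsSupremumOf : ∀ {ℓ} → Pred Carrier ℓ → Carrier → Set (c ⊔ˡ ℓ₂ ⊔ˡ ℓ)
  IsSupremumOf P s = (∀ g → P g → g ≤ s) × (∀ b → (∀ g → P g → g ≤ b) → s ≤ b)

  GuaranteedRatio : Carrier → Pred Carrier (c ⊔ˡ ℓ₁ ⊔ˡ ℓ₂)
  GuaranteedRatio θ g =
    ∀ {n} (D : WeightedDigraph n) → let open WeightedDigraph D in
    (0<w : 0# < totalWeight) → imbalance 0<w ≈ θ → g * totalWeight ≤ mac D

  -- y = f(θ)
  IsF : Carrier → Carrier → Set (c ⊔ˡ ℓ₁ ⊔ˡ ℓ₂)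
  IsF θ y = IsSupremumOf (GuaranteedRatio θ) y

  0<4[1-2θ] : ∀ {θ} → θ < ⅓ → 0# < fromℕ 4 * (1# - fromℕ 2 * θ)
  0<4[1-2θ] {θ} θ<⅓ = *-pos (0<fromℕ 3) (x<y⇒0<y-x 2θ<1)
    where
    expand : ∀ n x → fromℕ (ℕ.suc n) * x ≈ x + fromℕ n * x
    expand n x = trans (distribʳ x 1# (fromℕ n)) (+-congʳ (*-identityˡ x))

    2θ≈ : θ + (θ + 0#) ≈ fromℕ 2 * θ
    2θ≈ = sym (trans (expand 1 θ) (+-congˡ (trans (expand 0 θ) (+-congˡ (zeroˡ θ)))))

    ⅓+⅓+⅓≈1 : ⅓ + (⅓ + ⅓) ≈ 1#
    ⅓+⅓+⅓≈1 = trans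
      (sym (trans (expand 2 ⅓) (+-congˡ (trans (expand 1 ⅓) (+-congˡ
        (trans (expand 0 ⅓) (trans (+-congˡ (zeroˡ ⅓)) (+-identityʳ ⅓))))))))
      (recip-inverseʳ (fromℕ 3) (0<fromℕ 2))

    2θ<1 : fromℕ 2 * θ < 1#
    2θ<1 = <-cong 2θ≈ ⅓+⅓+⅓≈1
      (+-mono-< θ<⅓ (+-mono-< θ<⅓ (0<recip (fromℕ 3) (0<fromℕ 2))))

  -- y = l(θ).  As θ < ⅓ is not decidable, the definition of l by cases is given
  -- by its graph.
  IsL : Carrier → Carrier → Set (ℓ₁ ⊔ˡ ℓ₂)
  IsL θ y =
    ((θ<⅓ : θ < ⅓) →
       y ≈ ¼ + (θ * θ) * recip (fromℕ 4 * (1# - fromℕ 2 * θ)) (0<4[1-2θ] θ<⅓))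
    × (⅓ ≤ θ → y ≈ θ)

{-# OPTIONS --safe #-}
module Submission where

open import Defs
open import Level using (Level)
open import Algebra.Bundles using (CommutativeRing)
open import Algebra.Apartness.Bundles using (HeytingCommutativeRing)
open import Algebra.Solver.Ring.AlmostCommutativeRing
  using (fromCommutativeRing; _-Raw-AlmostCommutative⟶_)
import Algebra.Properties.Ring as RingProperties
import Algebra.Properties.Semiring.Mult as Mult
import Algebra.Properties.Semiring.Sum as Sum
import Algebra.Solver.Ring as RingSolver
open import Data.Bool.Base using (Bool; true; false; if_then_else_; not; _∧_)
open import Data.Empty using (⊥-elim)
open import Data.Fin.Base using (Fin; zero; suc)
open import Data.Fin.Properties using (_≟_; sequence; suc-injective)
open import Data.Fin.Subset using (Subset; inside; outside)
open import Data.Integer.Base as ℤ using (ℤ; +_; -[1+_]; _◃_; _⊖_)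
import Data.Integer.Properties as ℤ
open import Data.Maybe.Base using (Maybe; nothing; just; fromMaybe)
import Data.Maybe.Relation.Unary.All as All
open import Data.Nat.Base as ℕ using (ℕ; zero; suc)
import Data.Nat.Properties as ℕ
open import Data.Product.Base using (∃; _×_; _,_; proj₁; proj₂)
import Data.Sign.Base as Sign
open import Data.Sum.Base using (inj₁; inj₂)
open import Data.Vec.Base using ([]; _∷_; lookup)
open import Effect.Monad using (RawMonad)
open import Function.Base using (_∘_; id)
open import Relation.Binary.Structures using (IsPreorder)
open import Relation.Binary.PropositionalEquality.Core as ≡ using (_≡_; _≢_)
import Relation.Binary.Reasoning.Base.Triple as TripleReasoning
import Relation.Binary.Reasoning.Setoid as SetoidReasoning
open import Relation.Nullary.Decidable.Core using (yes; no)
open import Relation.Nullary.Negation using (¬_; ¬¬-Monad)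

-- If X contains each vertex with r > 0 with probability α and each other vertex with
-- probability 1 − α, then the expected weight of the cut is at least
-- (α(1 − α) + α(2α − 1)θ) w, and the best α ∈ [0 , 1] gives l(θ) w.  Conversely, take
-- two classes of K = M + 1 vertices with weight (1 − θ)K on every arc inside a class
-- and weight 2θM on every arc from the first class to the second.  The imbalance is
-- exactly θ, and a cut with s vertices of the first class inside X and t of the second
-- outside X weighs M((1 − θ)(s(K − s) + t(K − t)) + 2θst), up to an error of order
-- w / M.  This quadratic form is at most 2K² l(θ) for 0 ≤ s , t ≤ K, and w = 2K²M.

-- A ring solver with integer coefficients for an arbitrary commutative ring

module IntegerRingSolver {c ℓ} (R : CommutativeRing c ℓ) where

  open CommutativeRing R
  open RingProperties ring
    using (-‿distribˡ-*; -‿distribʳ-*; -‿involutive; -‿+-comm; -0#≈0#)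
  open Mult semiring using (×-homo-+; ×1-homo-*) renaming (_×_ to _·_)
  open SetoidReasoning setoid

  private
    ι : ℤ → Carrier
    ι (+ n)    = n · 1#
    ι -[1+ n ] = - (suc n · 1#)

    cancel-1+ : ∀ x y → x - y ≈ (1# + x) - (1# + y)
    cancel-1+ x y = sym (begin
      (1# + x) - (1# + y)    ≈⟨ +-cong (+-comm 1# x) (sym (-‿+-comm 1# y)) ⟩
      (x + 1#) + (- 1# - y)  ≈⟨ +-assoc x 1# _ ⟩
      x + (1# + (- 1# - y))  ≈⟨ +-congˡ (sym (+-assoc 1# (- 1#) (- y))) ⟩
      x + ((1# - 1#) - y)    ≈⟨ +-congˡ (+-congʳ (-‿inverseʳ 1#)) ⟩
      x + (0# - y)           ≈⟨ +-congˡ (+-identityˡ (- y)) ⟩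
      x - y                  ∎)

    ι-⊖ : ∀ m n → ι (m ⊖ n) ≈ m · 1# - n · 1#
    ι-⊖ zero    zero    = sym (-‿inverseʳ 0#)
    ι-⊖ zero    (suc n) = sym (+-identityˡ _)
    ι-⊖ (suc m) zero    = sym (trans (+-congˡ -0#≈0#) (+-identityʳ _))
    ι-⊖ (suc m) (suc n) = begin
      ι (suc m ⊖ suc n)                ≡⟨ ≡.cong ι (ℤ.[1+m]⊖[1+n]≡m⊖n m n) ⟩
      ι (m ⊖ n)                        ≈⟨ ι-⊖ m n ⟩
      m · 1# - n · 1#                  ≈⟨ cancel-1+ _ _ ⟩
      suc m · 1# - suc n · 1#          ∎

    ι-+ : ∀ i j → ι (i ℤ.+ j) ≈ ι i + ι j
    ι-+ (+ m)    (+ n)    = ×-homo-+ 1# m n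
    ι-+ (+ m)    -[1+ n ] = ι-⊖ m (suc n)
    ι-+ -[1+ m ] (+ n)    = trans (ι-⊖ n (suc m)) (+-comm _ _)
    ι-+ -[1+ m ] -[1+ n ] = begin
      - (suc (suc (m ℕ.+ n)) · 1#)       ≡⟨ ≡.cong (λ k → - (suc k · 1#)) (≡.sym (ℕ.+-suc m n)) ⟩
      - ((suc m ℕ.+ suc n) · 1#)         ≈⟨ -‿cong (×-homo-+ 1# (suc m) (suc n)) ⟩
      - (suc m · 1# + suc n · 1#)        ≈⟨ sym (-‿+-comm _ _) ⟩
      - (suc m · 1#) - suc n · 1#        ∎

    ι-neg : ∀ i → ι (ℤ.- i) ≈ - ι i
    ι-neg (+ zero)  = sym -0#≈0#
    ι-neg (+ suc n) = refl
    ι-neg -[1+ n ]  = sym (-‿involutive _)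

    ι-◃⁻ : ∀ n → ι (Sign.- ◃ n) ≈ - (n · 1#)
    ι-◃⁻ zero    = sym -0#≈0#
    ι-◃⁻ (suc n) = refl

    ι-◃⁺ : ∀ n → ι (Sign.+ ◃ n) ≈ n · 1#
    ι-◃⁺ zero    = refl
    ι-◃⁺ (suc n) = refl

    ι-* : ∀ i j → ι (i ℤ.* j) ≈ ι i * ι j
    ι-* (+ m)    (+ n)    = trans (ι-◃⁺ (m ℕ.* n)) (×1-homo-* m n)
    ι-* (+ m)    -[1+ n ] = begin
      ι (Sign.- ◃ (m ℕ.* suc n))  ≈⟨ ι-◃⁻ (m ℕ.* suc n) ⟩
      - ((m ℕ.* suc n) · 1#)      ≈⟨ -‿cong (×1-homo-* m (suc n)) ⟩
      - (m · 1# * (suc n · 1#))   ≈⟨ -‿distribʳ-* _ _ ⟩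
      m · 1# * - (suc n · 1#)     ∎
    ι-* -[1+ m ] (+ n)    = begin
      ι (Sign.- ◃ (suc m ℕ.* n))  ≈⟨ ι-◃⁻ (suc m ℕ.* n) ⟩
      - ((suc m ℕ.* n) · 1#)      ≈⟨ -‿cong (×1-homo-* (suc m) n) ⟩
      - (suc m · 1# * (n · 1#))   ≈⟨ -‿distribˡ-* _ _ ⟩
      - (suc m · 1#) * (n · 1#)   ∎
    ι-* -[1+ m ] -[1+ n ] = begin
      (suc m ℕ.* suc n) · 1#            ≈⟨ ×1-homo-* (suc m) (suc n) ⟩
      suc m · 1# * (suc n · 1#)         ≈⟨ sym (-‿involutive _) ⟩
      - - (suc m · 1# * (suc n · 1#))   ≈⟨ -‿cong (-‿distribˡ-* _ _) ⟩
      - (- (suc m · 1#) * (suc n · 1#)) ≈⟨ -‿distribʳ-* _ _ ⟩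
      - (suc m · 1#) * - (suc n · 1#)   ∎

    -- Differs from ι only in evaluating 1 to 1# instead of 1# + 0#, so that both
    -- 1# and the numerals n · 1# with n ≠ 1 are constants of the solver.
    ⟦_⟧ : ℤ → Carrier
    ⟦ + 1 ⟧ = 1#
    ⟦ i   ⟧ = ι i

    ⟦⟧≈ι : ∀ i → ⟦ i ⟧ ≈ ι i
    ⟦⟧≈ι (+ 0)           = refl
    ⟦⟧≈ι (+ 1)           = sym (+-identityʳ 1#)
    ⟦⟧≈ι (+ suc (suc n)) = refl
    ⟦⟧≈ι -[1+ n ]        = refl

    morphism : ℤ.+-*-rawRing -Raw-AlmostCommutative⟶ fromCommutativeRing R
    morphism = record
      { ⟦_⟧    = ⟦_⟧
      ; +-homo = λ i j → trans (⟦⟧≈ι (i ℤ.+ j))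
                   (trans (ι-+ i j) (sym (+-cong (⟦⟧≈ι i) (⟦⟧≈ι j))))
      ; *-homo = λ i j → trans (⟦⟧≈ι (i ℤ.* j))
                   (trans (ι-* i j) (sym (*-cong (⟦⟧≈ι i) (⟦⟧≈ι j))))
      ; -‿homo = λ i → trans (⟦⟧≈ι (ℤ.- i)) (trans (ι-neg i) (-‿cong (sym (⟦⟧≈ι i))))
      ; 0-homo = refl
      ; 1-homo = refl
      }

    -- Equality in `R` need not be decidable, so coefficients are compared as integers. This is what
    -- lets the solver collect and cancel terms over the reals.
    _≟⟦⟧_ : ∀ i j → Maybe (⟦ i ⟧ ≈ ⟦ j ⟧)
    i ≟⟦⟧ j with i ℤ.≟ j
    ... | yes ≡.refl = just refl
    ... | no  _      = nothing

  open RingSolver ℤ.+-*-rawRing (fromCommutativeRing R) morphism _≟⟦⟧_ public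

module MaxCut {c ℓ₁ ℓ₂ : Level} (ℝ : RealNumbers c ℓ₁ ℓ₂) where

  open Real ℝ hiding (zero)

  private
    commutativeRing : CommutativeRing c ℓ₁
    commutativeRing = HeytingCommutativeRing.commutativeRing heytingCommutativeRing

  open CommutativeRing commutativeRing using (semiring)
  open IntegerRingSolver commutativeRing using (solve; con; _:=_; _:+_; _:*_; _:-_; :-_)
  open Sum semiring using (sum; sum-cong-≋; ∑-distrib-+; ∑-comm; *-distribˡ-sum; *-distribʳ-sum)

  private variable
    u v x y z : Carrier
    n : ℕ

  -- Order

  <-asym : x < y → ¬ (y < x)
  <-asym x<y y<x = <.irrefl refl (<.trans x<y y<x)

  ≤-reflexive : x ≈ y → x ≤ y
  ≤-reflexive x≈y y<x = <.irrefl (sym x≈y) y<x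

  ≤∧#⇒< : x ≤ y → x # y → x < y
  ≤∧#⇒< x≤y x#y with #⇒<⊎> x#y
  ... | inj₁ x<y = x<y
  ... | inj₂ y<x = ⊥-elim (x≤y y<x)

  -- Since `≤` is only a negated `<`, the strict conclusion has to come from apartness:
  -- cotransitivity compares `z` with `x` or with `y`, and the unwanted order is refuted in each
  -- case.
  <-≤-trans : x < y → y ≤ z → x < z
  <-≤-trans {z = z} x<y y≤z with #-cotrans (<⇒# x<y) z
  ... | inj₂ z#y = <.trans x<y (≤∧#⇒< y≤z (#-sym z#y))
  ... | inj₁ x#z with #⇒<⊎> x#z
  ...   | inj₁ x<z = x<z
  ...   | inj₂ z<x = ⊥-elim (y≤z (<.trans z<x x<y))

  ≤-<-trans : x ≤ y → y < z → x < z
  ≤-<-trans {x = x} x≤y y<z with #-cotrans (<⇒# y<z) x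
  ... | inj₁ y#x = <.trans (≤∧#⇒< x≤y (#-sym y#x)) y<z
  ... | inj₂ x#z with #⇒<⊎> x#z
  ...   | inj₁ x<z = x<z
  ...   | inj₂ z<x = ⊥-elim (x≤y (<.trans y<z z<x))

  ≤-trans : x ≤ y → y ≤ z → x ≤ z
  ≤-trans x≤y y≤z z<x = x≤y (≤-<-trans y≤z z<x)

  ≤-antisym : x ≤ y → y ≤ x → x ≈ y
  ≤-antisym {x} {y} x≤y y≤x = proj₁ (tight x y) λ x#y → y≤x (≤∧#⇒< x≤y x#y)

  ≤-isPreorder : IsPreorder _≈_ _≤_
  ≤-isPreorder = record
    { isEquivalence = isEquivalence
    ; reflexive     = ≤-reflexive
    ; trans         = ≤-trans
    }

  <⇒≤ : x < y → x ≤ y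
  <⇒≤ = <-asym

  open TripleReasoning ≤-isPreorder <-asym <.trans <.<-resp-≈ <⇒≤ <-≤-trans ≤-<-trans

  -- The order is undecidable, but negative statements may be proved by cases.
  ≤-cases : ∀ x y → (x < y → u ≤ v) → (y ≤ x → u ≤ v) → u ≤ v
  ≤-cases x y below above v<u = above (λ x<y → below x<y v<u) v<u

  0≤y-x⇒x≤y : 0# ≤ y - x → x ≤ y
  0≤y-x⇒x≤y {y} {x} 0≤y-x y<x = 0≤y-x (begin-strict
    y - x  <⟨ +-monoˡ-< (- x) y<x ⟩
    x - x  ≈⟨ -‿inverseʳ x ⟩
    0#     ∎)

  x≤y⇒0≤y-x : x ≤ y → 0# ≤ y - x
  x≤y⇒0≤y-x {x} {y} x≤y y-x<0 = x≤y (begin-strict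
    y          ≈⟨ solve 2 (λ x y → y := y :- x :+ x) refl x y ⟩
    y - x + x  <⟨ +-monoˡ-< x y-x<0 ⟩
    0# + x     ≈⟨ +-identityˡ x ⟩
    x          ∎)

  -- The standard form of the polynomial estimates below: the ring solver rewrites the difference as
  -- an expression that is visibly nonnegative.
  ≤-by-difference : y - x ≈ z → 0# ≤ z → x ≤ y
  ≤-by-difference y-x≈z 0≤z = 0≤y-x⇒x≤y (≤-trans 0≤z (≤-reflexive (sym y-x≈z)))

  x<y⇒0<y-x : x < y → 0# < y - x
  x<y⇒0<y-x {x} {y} x<y = begin-strict
    0#     ≈⟨ -‿inverseʳ x ⟨
    x - x  <⟨ +-monoˡ-< (- x) x<y ⟩
    y - x  ∎

  +-monoˡ-≤ : ∀ z → x ≤ y → x + z ≤ y + z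
  +-monoˡ-≤ {x} {y} z x≤y = ≤-by-difference
    (solve 3 (λ x y z → y :+ z :- (x :+ z) := y :- x) refl x y z) (x≤y⇒0≤y-x x≤y)

  +-mono-≤ : x ≤ y → u ≤ v → x + u ≤ y + v
  +-mono-≤ {x} {y} {u} {v} x≤y u≤v = begin
    x + u  ≤⟨ +-monoˡ-≤ u x≤y ⟩
    y + u  ≈⟨ +-comm y u ⟩
    u + y  ≤⟨ +-monoˡ-≤ y u≤v ⟩
    v + y  ≈⟨ +-comm v y ⟩
    y + v  ∎

  0≤+ : 0# ≤ x → 0# ≤ y → 0# ≤ x + y
  0≤+ 0≤x 0≤y = ≤-trans (≤-reflexive (sym (+-identityʳ 0#))) (+-mono-≤ 0≤x 0≤y)

  -- A nonnegative factor that is not positive is zero by antisymmetry, and `*-pos` covers the rest.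
  -- The case split is legitimate because the goal is a negation.
  0≤* : 0# ≤ x → 0# ≤ y → 0# ≤ x * y
  0≤* {x} {y} 0≤x 0≤y = ≤-cases 0# x
    (λ 0<x → ≤-cases 0# y
      (λ 0<y → <⇒≤ (*-pos 0<x 0<y))
      (λ y≤0 → ≤-reflexive (sym (trans (*-congˡ (≤-antisym y≤0 0≤y)) (zeroʳ x)))))
    (λ x≤0 → ≤-reflexive (sym (trans (*-congʳ (≤-antisym x≤0 0≤x)) (zeroˡ y))))

  0≤x*x : ∀ x → 0# ≤ x * x
  0≤x*x x = ≤-cases 0# x
    (λ 0<x → <⇒≤ (*-pos 0<x 0<x))
    (λ x≤0 → ≤-trans (0≤* (0≤0-x x≤0) (0≤0-x x≤0))
      (≤-reflexive (solve 1 (λ x → (con (+ 0) :- x) :* (con (+ 0) :- x) := x :* x) refl x)))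
    where
    0≤0-x : x ≤ 0# → 0# ≤ 0# - x
    0≤0-x = x≤y⇒0≤y-x

  *-monoˡ-≤ : ∀ z → 0# ≤ z → x ≤ y → z * x ≤ z * y
  *-monoˡ-≤ {x} {y} z 0≤z x≤y = ≤-by-difference
    (solve 3 (λ x y z → z :* y :- z :* x := z :* (y :- x)) refl x y z)
    (0≤* 0≤z (x≤y⇒0≤y-x x≤y))

  *-cancelˡ-≤ : ∀ z → 0# < z → z * x ≤ z * y → x ≤ y
  *-cancelˡ-≤ {x} {y} z 0<z zx≤zy y<x = zx≤zy (begin-strict
    z * y                ≈⟨ +-identityˡ (z * y) ⟨
    0# + z * y           <⟨ +-monoˡ-< (z * y) (*-pos 0<z (x<y⇒0<y-x y<x)) ⟩
    z * (x - y) + z * y  ≈⟨ solve 3 (λ x y z → z :* (x :- y) :+ z :* y := z :* x) refl x y z ⟩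
    z * x                ∎)

  *-cancelˡ-≈ : ∀ z → 0# < z → z * x ≈ z * y → x ≈ y
  *-cancelˡ-≈ z 0<z zx≈zy = ≤-antisym
    (*-cancelˡ-≤ z 0<z (≤-reflexive zx≈zy))
    (*-cancelˡ-≤ z 0<z (≤-reflexive (sym zx≈zy)))

  0<1 : 0# < 1#
  0<1 = begin-strict
    0#       <⟨ 0<fromℕ 0 ⟩
    1# + 0#  ≈⟨ +-identityʳ 1# ⟩
    1#       ∎

  0≤fromℕ : ∀ n → 0# ≤ fromℕ n
  0≤fromℕ zero    = ≤-reflexive refl
  0≤fromℕ (suc n) = <⇒≤ (0<fromℕ n)

  x≤x⊔y : ∀ x y → x ≤ x ⊔ y
  x≤x⊔y x y = proj₁ (⊔-supremum x y)

  y≤x⊔y : ∀ x y → y ≤ x ⊔ y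
  y≤x⊔y x y = proj₁ (proj₂ (⊔-supremum x y))

  ⊔-least : x ≤ z → y ≤ z → x ⊔ y ≤ z
  ⊔-least {x} {z} {y} = proj₂ (proj₂ (⊔-supremum x y)) z

  x≥0⇒x⊔0≈x : 0# ≤ x → x ⊔ 0# ≈ x
  x≥0⇒x⊔0≈x {x} 0≤x = ≤-antisym (⊔-least (≤-reflexive refl) 0≤x) (x≤x⊔y x 0#)

  x≤0⇒x⊔0≈0 : x ≤ 0# → x ⊔ 0# ≈ 0#
  x≤0⇒x⊔0≈0 {x} x≤0 = ≤-antisym (⊔-least x≤0 (≤-reflexive refl)) (y≤x⊔y x 0#)

  -- Finite sums

  sum-mono-≤ : {f g : Fin n → Carrier} → (∀ i → f i ≤ g i) → sum f ≤ sum g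
  sum-mono-≤ {zero}  f≤g = ≤-reflexive refl
  sum-mono-≤ {suc n} f≤g = +-mono-≤ (f≤g zero) (sum-mono-≤ (λ i → f≤g (suc i)))

  0≤sum : {f : Fin n → Carrier} → (∀ i → 0# ≤ f i) → 0# ≤ sum f
  0≤sum {zero}  0≤f = ≤-reflexive refl
  0≤sum {suc n} 0≤f = 0≤+ (0≤f zero) (0≤sum (λ i → 0≤f (suc i)))

  sum-cong₂ : ∀ {m n} {f g : Fin m → Fin n → Carrier} → (∀ i j → f i j ≈ g i j) →
              (sum λ i → sum (f i)) ≈ (sum λ i → sum (g i))
  sum-cong₂ f≈g = sum-cong-≋ λ i → sum-cong-≋ (f≈g i)

  sum-neg : (f : Fin n → Carrier) → (sum λ i → - f i) ≈ - sum f
  sum-neg {zero}  f = solve 0 (con (+ 0) := :- con (+ 0)) refl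
  sum-neg {suc n} f = trans (+-congˡ (sum-neg (λ i → f (suc i))))
    (solve 2 (λ x y → :- x :+ :- y := :- (x :+ y)) refl (f zero) _)

  sum-sub : (f g : Fin n → Carrier) → (sum λ i → f i - g i) ≈ sum f - sum g
  sum-sub f g = trans (∑-distrib-+ f (λ i → - g i)) (+-congˡ (sum-neg g))

  sum-product : ∀ {m n} (f : Fin m → Carrier) (g : Fin n → Carrier) →
                (sum λ i → sum λ j → f i * g j) ≈ sum f * sum g
  sum-product f g = trans (sum-cong-≋ λ i → sym (*-distribˡ-sum (f i) g))
                          (sym (*-distribʳ-sum (sum g) f))

  -- Used to correct for the missing loop when the weights at a vertex are summed by class.
  sum-change-one : (f g : Fin n → Carrier) (i : Fin n) → (∀ j → i ≢ j → f j ≈ g j) →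
                   sum f ≈ sum g + (f i - g i)
  sum-change-one f g zero f≈g =
    trans (+-congˡ (sum-cong-≋ λ j → f≈g (suc j) λ ()))
      (solve 3 (λ a b c → a :+ c := b :+ c :+ (a :- b)) refl (f zero) (g zero) _)
  sum-change-one f g (suc i) f≈g =
    trans (+-cong (f≈g zero λ ())
                  (sum-change-one (λ j → f (suc j)) (λ j → g (suc j)) i
                     λ j i≢j → f≈g (suc j) (i≢j ∘ suc-injective)))
      (sym (+-assoc _ _ _))

  -- Random cuts

  χ : Bool → Carrier
  χ true  = 1#
  χ false = 0#

  mix : Carrier → Carrier → Carrier → Carrier
  mix p x y = p * x + (1# - p) * y

  mix-idem : ∀ p x → mix p x x ≈ x
  mix-idem = solve 2 (λ p x → p :* x :+ (con (+ 1) :- p) :* x := x) refl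

  mix-cong : ∀ p → x ≈ u → y ≈ v → mix p x y ≈ mix p u v
  mix-cong p x≈u y≈v = +-cong (*-congˡ x≈u) (*-congˡ y≈v)

  mix-≤ : ∀ p → 0# ≤ p → p ≤ 1# → x ≤ z → y ≤ z → mix p x y ≤ z
  mix-≤ {x} {z} {y} p 0≤p p≤1 x≤z y≤z = begin
    mix p x y  ≤⟨ +-mono-≤ (*-monoˡ-≤ p 0≤p x≤z) (*-monoˡ-≤ (1# - p) (x≤y⇒0≤y-x p≤1) y≤z) ⟩
    mix p z z  ≈⟨ mix-idem p z ⟩
    z          ∎

  -- The expectation of φ X, where every vertex v is in X with probability p v,
  -- independently of the others.
  𝔼 : (Fin n → Carrier) → (Subset n → Carrier) → Carrier
  𝔼 {zero}  p φ = φ []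
  𝔼 {suc n} p φ = mix (p zero) (𝔼 (p ∘ suc) (φ ∘ (inside ∷_))) (𝔼 (p ∘ suc) (φ ∘ (outside ∷_)))

  𝔼-const : (p : Fin n → Carrier) (x : Carrier) → 𝔼 p (λ _ → x) ≈ x
  𝔼-const {zero}  p x = refl
  𝔼-const {suc n} p x =
    trans (mix-cong (p zero) (𝔼-const (p ∘ suc) x) (𝔼-const (p ∘ suc) x)) (mix-idem (p zero) x)

  𝔼-+ : (p : Fin n → Carrier) (φ ψ : Subset n → Carrier) →
        𝔼 p (λ X → φ X + ψ X) ≈ 𝔼 p φ + 𝔼 p ψ
  𝔼-+ {zero}  p φ ψ = refl
  𝔼-+ {suc n} p φ ψ = trans
    (mix-cong (p zero) (𝔼-+ (p ∘ suc) (φ ∘ (inside ∷_)) (ψ ∘ (inside ∷_)))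
                       (𝔼-+ (p ∘ suc) (φ ∘ (outside ∷_)) (ψ ∘ (outside ∷_))))
    (solve 5 (λ p a b c d → p :* (a :+ b) :+ (con (+ 1) :- p) :* (c :+ d) :=
                p :* a :+ (con (+ 1) :- p) :* c :+ (p :* b :+ (con (+ 1) :- p) :* d))
       refl (p zero) _ _ _ _)

  𝔼-sum : ∀ {m} (p : Fin n → Carrier) (φ : Fin m → Subset n → Carrier) →
          𝔼 p (λ X → sum λ i → φ i X) ≈ sum λ i → 𝔼 p (φ i)
  𝔼-sum {m = zero}  p φ = 𝔼-const p 0#
  𝔼-sum {m = suc m} p φ =
    trans (𝔼-+ p (φ zero) _) (+-congˡ (𝔼-sum p (λ i → φ (suc i))))

  -- Every coordinate other than `v` averages two equal values and disappears by `mix-idem`.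
  𝔼-lookup : (p : Fin n → Carrier) (v : Fin n) (f : Bool → Carrier) →
             𝔼 p (λ X → f (lookup X v)) ≈ mix (p v) (f true) (f false)
  𝔼-lookup p zero    f =
    mix-cong (p zero) (𝔼-const (p ∘ suc) (f true)) (𝔼-const (p ∘ suc) (f false))
  𝔼-lookup p (suc v) f =
    trans (mix-cong (p zero) (𝔼-lookup (p ∘ suc) v f) (𝔼-lookup (p ∘ suc) v f))
          (mix-idem (p zero) _)

  -- Independence of two distinct coordinates: the joint law is an iterated average.
  𝔼-lookup₂ : (p : Fin n → Carrier) {u v : Fin n} → u ≢ v → (f : Bool → Bool → Carrier) →
              𝔼 p (λ X → f (lookup X u) (lookup X v)) ≈
              mix (p u) (mix (p v) (f true true) (f true false))
                        (mix (p v) (f false true) (f false false))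
  𝔼-lookup₂ p {zero}  {zero}  u≢v f = ⊥-elim (u≢v ≡.refl)
  𝔼-lookup₂ p {zero}  {suc v} u≢v f =
    mix-cong (p zero) (𝔼-lookup (p ∘ suc) v (f true)) (𝔼-lookup (p ∘ suc) v (f false))
  𝔼-lookup₂ p {suc u} {zero}  u≢v f = trans
    (mix-cong (p zero) (𝔼-lookup (p ∘ suc) u (λ b → f b true))
                       (𝔼-lookup (p ∘ suc) u (λ b → f b false)))
    -- Here `v` is the first coordinate and is averaged outermost, so the two averages have to be
    -- interchanged.
    (solve 6 (λ p q a b c d →
        p :* (q :* a :+ (con (+ 1) :- q) :* c) :+ (con (+ 1) :- p) :* (q :* b :+ (con (+ 1) :- q) :* d)
        := q :* (p :* a :+ (con (+ 1) :- p) :* b) :+ (con (+ 1) :- q) :* (p :* c :+ (con (+ 1) :- p) :* d))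
       refl (p zero) (p (suc u)) _ _ _ _)
  𝔼-lookup₂ p {suc u} {suc v} u≢v f = trans
    (mix-cong (p zero) (𝔼-lookup₂ (p ∘ suc) (u≢v ∘ ≡.cong suc) f)
                       (𝔼-lookup₂ (p ∘ suc) (u≢v ∘ ≡.cong suc) f))
    (mix-idem (p zero) _)

  -- The probabilistic method: some outcome is at least as good as the average, one coordinate at a
  -- time.
  𝔼≤maxOverSubsets : (p : Fin n → Carrier) → (∀ v → 0# ≤ p v) → (∀ v → p v ≤ 1#) →
                     (φ : Subset n → Carrier) → 𝔼 p φ ≤ maxOverSubsets n φ
  𝔼≤maxOverSubsets {zero}  p 0≤p p≤1 φ = ≤-reflexive refl
  𝔼≤maxOverSubsets {suc n} p 0≤p p≤1 φ = mix-≤ (p zero) (0≤p zero) (p≤1 zero)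
    (≤-trans (𝔼≤maxOverSubsets (p ∘ suc) (0≤p ∘ suc) (p≤1 ∘ suc) _) (x≤x⊔y _ _))
    (≤-trans (𝔼≤maxOverSubsets (p ∘ suc) (0≤p ∘ suc) (p≤1 ∘ suc) _) (y≤x⊔y _ _))

  maxOverSubsets-least : ∀ n {φ : Subset n → Carrier} → (∀ X → φ X ≤ z) → maxOverSubsets n φ ≤ z
  maxOverSubsets-least zero    φ≤z = φ≤z []
  maxOverSubsets-least (suc n) φ≤z =
    ⊔-least (maxOverSubsets-least n λ X → φ≤z (inside ∷ X))
            (maxOverSubsets-least n λ X → φ≤z (outside ∷ X))

  module RandomCut {n} (D : WeightedDigraph n) (α : Carrier) (0≤α : 0# ≤ α) (α≤1 : α ≤ 1#) where

    open WeightedDigraph D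

    bias : Bool → Carrier
    bias true  = α
    bias false = 1# - α

    0≤bias : ∀ b → 0# ≤ bias b
    0≤bias true  = 0≤α
    0≤bias false = x≤y⇒0≤y-x α≤1

    bias≤1 : ∀ b → bias b ≤ 1#
    bias≤1 true  = α≤1
    bias≤1 false = ≤-by-difference
      (solve 1 (λ α → con (+ 1) :- (con (+ 1) :- α) := α) refl α) 0≤α

    -- Inside either class an arc is cut with probability `κ`, and from `true` to `false` with
    -- probability α² = `κ` + `ƛ`. Interpolating linearly in the difference of the indicators makes
    -- the sum over all arcs depend only on the total weight and on `r`.
    κ ƛ : Carrier
    κ = α * (1# - α)
    ƛ = α * (fromℕ 2 * α - 1#)

    -- An equality except when b is false and b′ is true.
    bias-bound : ∀ b b′ → κ + ƛ * (χ b - χ b′) ≤ bias b * (1# - bias b′)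
    bias-bound true true = ≤-reflexive (solve 1 (λ α →
      α :* (con (+ 1) :- α) :+ α :* (con (+ 2) :* α :- con (+ 1)) :* (con (+ 1) :- con (+ 1))
        := α :* (con (+ 1) :- α)) refl α)
    bias-bound true false = ≤-reflexive (solve 1 (λ α →
      α :* (con (+ 1) :- α) :+ α :* (con (+ 2) :* α :- con (+ 1)) :* (con (+ 1) :- con (+ 0))
        := α :* (con (+ 1) :- (con (+ 1) :- α))) refl α)
    bias-bound false true = ≤-by-difference (solve 1 (λ α →
      (con (+ 1) :- α) :* (con (+ 1) :- α)
        :- (α :* (con (+ 1) :- α) :+ α :* (con (+ 2) :* α :- con (+ 1)) :* (con (+ 0) :- con (+ 1)))
        := (con (+ 1) :- con (+ 2) :* α) :* (con (+ 1) :- con (+ 2) :* α)) refl α)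
      (0≤x*x _)
    bias-bound false false = ≤-reflexive (solve 1 (λ α →
      α :* (con (+ 1) :- α) :+ α :* (con (+ 2) :* α :- con (+ 1)) :* (con (+ 0) :- con (+ 0))
        := (con (+ 1) :- α) :* (con (+ 1) :- (con (+ 1) :- α))) refl α)

    0≤arcWeight : ∀ u v → 0# ≤ arcWeight u v
    0≤arcWeight u v with arc u v | nonNegative u v
    ... | just _  | All.just 0≤a = 0≤a
    ... | nothing | All.nothing  = ≤-reflexive refl

    arcWeight-loop : ∀ v → arcWeight v v ≡ 0#
    arcWeight-loop v = ≡.cong (fromMaybe 0#) (loopless v)

    module _ (β : Fin n → Bool) where

      𝔼-arc : ∀ u v → arcWeight u v * (κ + ƛ * (χ (β u) - χ (β v))) ≤
        𝔼 (bias ∘ β) (λ X → if lookup X u ∧ not (lookup X v) then arcWeight u v else 0#)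
      𝔼-arc u v with u ≟ v
      -- The two ends of a loop are not independent, but its weight is zero, so both sides vanish.
      ... | yes ≡.refl = ≤-reflexive (begin-equality
        arcWeight u u * _                    ≈⟨ *-congʳ (reflexive (arcWeight-loop u)) ⟩
        0# * _                               ≈⟨ zeroˡ _ ⟩
        0#                                   ≈⟨ mix-idem (bias (β u)) 0# ⟨
        mix (bias (β u)) 0# 0#               ≈⟨ 𝔼-lookup (bias ∘ β) u
                                                  (λ b → if b ∧ not b then arcWeight u u else 0#) ⟨
        _                                    ∎)
      ... | no u≢v = begin
        arcWeight u v * (κ + ƛ * (χ (β u) - χ (β v)))
          ≤⟨ *-monoˡ-≤ (arcWeight u v) (0≤arcWeight u v) (bias-bound (β u) (β v)) ⟩
        arcWeight u v * (bias (β u) * (1# - bias (β v)))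
          ≈⟨ solve 3 (λ a p q → a :* (p :* (con (+ 1) :- q)) :=
               p :* (q :* con (+ 0) :+ (con (+ 1) :- q) :* a) :+
               (con (+ 1) :- p) :* (q :* con (+ 0) :+ (con (+ 1) :- q) :* con (+ 0)))
               refl (arcWeight u v) (bias (β u)) (bias (β v)) ⟩
        _ ≈⟨ 𝔼-lookup₂ (bias ∘ β) u≢v (λ b b′ → if b ∧ not b′ then arcWeight u v else 0#) ⟨
        _ ∎

      -- Double counting: the indicator of a vertex is counted positively by each leaving arc and
      -- negatively by each entering arc.
      sum-χ*r : (sum λ u → sum λ v → arcWeight u v * (χ (β u) - χ (β v))) ≈ sum λ v → χ (β v) * r v
      sum-χ*r = begin-equality
        (sum λ u → sum λ v → arcWeight u v * (χ (β u) - χ (β v)))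
          ≈⟨ sum-cong₂ (λ u v → solve 3 (λ a b c → a :* (b :- c) := b :* a :- c :* a) refl
               (arcWeight u v) (χ (β u)) (χ (β v))) ⟩
        (sum λ u → sum λ v → χ (β u) * arcWeight u v - χ (β v) * arcWeight u v)
          ≈⟨ sum-cong-≋ (λ u → sum-sub (λ v → χ (β u) * arcWeight u v) (λ v → χ (β v) * arcWeight u v)) ⟩
        (sum λ u → (sum λ v → χ (β u) * arcWeight u v) - (sum λ v → χ (β v) * arcWeight u v))
          ≈⟨ sum-sub (λ u → sum λ v → χ (β u) * arcWeight u v)
                     (λ u → sum λ v → χ (β v) * arcWeight u v) ⟩
        (sum λ u → sum λ v → χ (β u) * arcWeight u v) - (sum λ u → sum λ v → χ (β v) * arcWeight u v)
          ≈⟨ +-congˡ (-‿cong (∑-comm (λ u v → χ (β v) * arcWeight u v))) ⟩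
        (sum λ v → sum λ u → χ (β v) * arcWeight v u) - (sum λ v → sum λ u → χ (β v) * arcWeight u v)
          ≈⟨ +-cong (sum-cong-≋ λ v → *-distribˡ-sum (χ (β v)) (λ u → arcWeight v u))
                    (-‿cong (sum-cong-≋ λ v → *-distribˡ-sum (χ (β v)) (λ u → arcWeight u v))) ⟨
        (sum λ v → χ (β v) * outWeight v) - (sum λ v → χ (β v) * inWeight v)
          ≈⟨ sum-sub (λ v → χ (β v) * outWeight v) (λ v → χ (β v) * inWeight v) ⟨
        (sum λ v → χ (β v) * outWeight v - χ (β v) * inWeight v)
          ≈⟨ sum-cong-≋ (λ v → solve 3 (λ b x y → b :* x :- b :* y := b :* (x :- y)) refl
               (χ (β v)) (outWeight v) (inWeight v)) ⟩
        (sum λ v → χ (β v) * r v) ∎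

      sum-κƛ : (sum λ u → sum λ v → arcWeight u v * (κ + ƛ * (χ (β u) - χ (β v)))) ≈
               κ * totalWeight + ƛ * (sum λ v → χ (β v) * r v)
      sum-κƛ = begin-equality
        (sum λ u → sum λ v → arcWeight u v * (κ + ƛ * (χ (β u) - χ (β v))))
          ≈⟨ sum-cong₂ (λ u v → solve 4 (λ a k l d → a :* (k :+ l :* d) := k :* a :+ l :* (a :* d)) refl
               (arcWeight u v) κ ƛ (χ (β u) - χ (β v))) ⟩
        (sum λ u → sum λ v → κ * arcWeight u v + ƛ * flow u v)
          ≈⟨ sum-cong-≋ (λ u → trans
               (∑-distrib-+ (λ v → κ * arcWeight u v) (λ v → ƛ * flow u v))
               (sym (+-cong (*-distribˡ-sum κ (arcWeight u)) (*-distribˡ-sum ƛ (flow u))))) ⟩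
        (sum λ u → κ * sum (arcWeight u) + ƛ * sum (flow u))
          ≈⟨ ∑-distrib-+ (λ u → κ * sum (arcWeight u)) (λ u → ƛ * sum (flow u)) ⟩
        (sum λ u → κ * sum (arcWeight u)) + (sum λ u → ƛ * sum (flow u))
          ≈⟨ +-cong (*-distribˡ-sum κ (λ u → sum (arcWeight u))) (*-distribˡ-sum ƛ (λ u → sum (flow u))) ⟨
        κ * totalWeight + ƛ * (sum λ u → sum (flow u))
          ≈⟨ +-congˡ (*-congˡ sum-χ*r) ⟩
        κ * totalWeight + ƛ * (sum λ v → χ (β v) * r v) ∎
        where
        flow : Fin n → Fin n → Carrier
        flow u v = arcWeight u v * (χ (β u) - χ (β v))

      κƛ≤mac : κ * totalWeight + ƛ * (sum λ v → χ (β v) * r v) ≤ mac D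
      κƛ≤mac = begin
        κ * totalWeight + ƛ * (sum λ v → χ (β v) * r v)
          ≈⟨ sum-κƛ ⟨
        (sum λ u → sum λ v → arcWeight u v * (κ + ƛ * (χ (β u) - χ (β v))))
          ≤⟨ sum-mono-≤ (λ u → sum-mono-≤ (𝔼-arc u)) ⟩
        (sum λ u → sum λ v → 𝔼 p (term u v))
          ≈⟨ sum-cong-≋ (λ u → 𝔼-sum p (term u)) ⟨
        (sum λ u → 𝔼 p (λ X → sum λ v → term u v X))
          ≈⟨ 𝔼-sum p (λ u X → sum λ v → term u v X) ⟨
        𝔼 p cutWeight
          ≤⟨ 𝔼≤maxOverSubsets p (0≤bias ∘ β) (bias≤1 ∘ β) cutWeight ⟩
        mac D ∎
        where
        p : Fin n → Carrier
        p = bias ∘ β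
        term : Fin n → Fin n → Subset n → Carrier
        term u v X = if lookup X u ∧ not (lookup X v) then arcWeight u v else 0#

    -- The sign of a real cannot be decided, so the class of a vertex is available only under a
    -- double negation.
    ¬¬sign : ∀ x → ¬ ¬ (∃ λ b → χ b * x ≈ x ⊔ 0#)
    ¬¬sign x ¬sign = ¬0<x λ 0<x → ¬sign (true , trans (*-identityˡ x) (sym (x≥0⇒x⊔0≈x (<⇒≤ 0<x))))
      where
      ¬0<x : ¬ ¬ (0# < x)
      ¬0<x x≤0 = ¬sign (false , trans (zeroˡ x) (sym (x≤0⇒x⊔0≈0 x≤0)))

    mac-bound : κ * totalWeight + ƛ * r⁺ ≤ mac D
    -- There are finitely many vertices, so the double negation moves outside the choice of all
    -- signs; the goal, being a negation, absorbs it.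
    mac-bound mac< = sequence (RawMonad.rawApplicative ¬¬-Monad) (¬¬sign ∘ r) λ sign →
      ≤-trans
        (≤-reflexive (+-congˡ (*-congˡ (sum-cong-≋ λ v → sym (proj₂ (sign v))))))
        (κƛ≤mac (proj₁ ∘ sign)) mac<

  -- The constants ¼ and ⅓, and comparison with the threshold

  ⅓-inverse : fromℕ 3 * ⅓ ≈ 1#
  ⅓-inverse = recip-inverseʳ (fromℕ 3) (0<fromℕ 2)

  ¼-inverse : fromℕ 4 * ¼ ≈ 1#
  ¼-inverse = recip-inverseʳ (fromℕ 4) (0<fromℕ 3)

  1-3θ≈3[⅓-θ] : ∀ θ → 1# - fromℕ 3 * θ ≈ fromℕ 3 * (⅓ - θ)
  1-3θ≈3[⅓-θ] θ = trans (+-congʳ (sym ⅓-inverse))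
    (solve 2 (λ a θ → con (+ 3) :* a :- con (+ 3) :* θ := con (+ 3) :* (a :- θ)) refl ⅓ θ)

  θ<⅓⇒0<1-3θ : ∀ {θ} → θ < ⅓ → 0# < 1# - fromℕ 3 * θ
  θ<⅓⇒0<1-3θ {θ} θ<⅓ = begin-strict
    0#                  <⟨ *-pos (0<fromℕ 2) (x<y⇒0<y-x θ<⅓) ⟩
    fromℕ 3 * (⅓ - θ)   ≈⟨ 1-3θ≈3[⅓-θ] θ ⟨
    1# - fromℕ 3 * θ    ∎

  ⅓≤θ⇒0≤3θ-1 : ∀ {θ} → ⅓ ≤ θ → 0# ≤ fromℕ 3 * θ - 1#
  ⅓≤θ⇒0≤3θ-1 {θ} ⅓≤θ = begin
    0#                    ≤⟨ 0≤* (0≤fromℕ 3) (x≤y⇒0≤y-x ⅓≤θ) ⟩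
    fromℕ 3 * (θ - ⅓)     ≈⟨ solve 2 (λ a θ → con (+ 3) :* (θ :- a) := con (+ 3) :* θ :- con (+ 3) :* a)
                               refl ⅓ θ ⟩
    fromℕ 3 * θ - fromℕ 3 * ⅓ ≈⟨ +-congˡ (-‿cong ⅓-inverse) ⟩
    fromℕ 3 * θ - 1#      ∎

  -- The function l

  module _ (θ : Carrier) where

    private
      excess : Carrier
      excess = (1# - fromℕ 3 * θ) ⊔ 0#

      denominator : Carrier
      denominator = fromℕ 4 * (1# + fromℕ 2 * excess)

      -- As the excess is a maximum with 0, the denominator is at least 4 on both sides of the
      -- threshold. Its reciprocal therefore exists without deciding whether θ < 1/3.
      0<denominator : 0# < denominator
      0<denominator = *-pos (0<fromℕ 3) (<-≤-trans 0<1 (≤-by-difference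
        (solve 1 (λ t → con (+ 1) :+ con (+ 2) :* t :- con (+ 1) := con (+ 2) :* t) refl excess)
        (0≤* (0≤fromℕ 2) (y≤x⊔y _ 0#))))

      recip-denominator : Carrier
      recip-denominator = recip denominator 0<denominator

    -- With t = max(1 − 3θ, 0), both cases of l(θ) are θ + 3t² / 4(1 + 2t): if
    -- θ < 1/3 then 1 + 2t = 3(1 − 2θ).
    l : Carrier
    l = θ + fromℕ 3 * (excess * excess) * recip-denominator

    ⅓≤θ⇒l≈θ : ⅓ ≤ θ → l ≈ θ
    ⅓≤θ⇒l≈θ ⅓≤θ = begin-equality
      θ + fromℕ 3 * (excess * excess) * recip-denominator
        ≈⟨ +-congˡ (*-congʳ (*-congˡ (*-congʳ (x≤0⇒x⊔0≈0 1-3θ≤0)))) ⟩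
      θ + fromℕ 3 * (0# * excess) * recip-denominator
        ≈⟨ solve 3 (λ θ t s → θ :+ con (+ 3) :* (con (+ 0) :* t) :* s := θ) refl θ excess _ ⟩
      θ ∎
      where
      1-3θ≤0 : 1# - fromℕ 3 * θ ≤ 0#
      1-3θ≤0 = ≤-by-difference
        (solve 1 (λ θ → con (+ 0) :- (con (+ 1) :- con (+ 3) :* θ) := con (+ 3) :* θ :- con (+ 1)) refl θ)
        (⅓≤θ⇒0≤3θ-1 ⅓≤θ)

    -- Below the threshold l(θ) is (1 - θ)² / 4(1 - 2θ). Both bounds use it in this form, free of
    -- division.
    θ<⅓⇒4[1-2θ]l : θ < ⅓ →
                   fromℕ 4 * (1# - fromℕ 2 * θ) * l ≈ (1# - θ) * (1# - θ)
    θ<⅓⇒4[1-2θ]l θ<⅓ = begin-equality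
      fromℕ 4 * (1# - fromℕ 2 * θ) * l
        -- The factor 3 is absorbed by 3(1 - 2θ) = 1 + 2(1 - 3θ), which produces the denominator of
        -- `l`.
        ≈⟨ solve 3 (λ θ t s →
             con (+ 4) :* (con (+ 1) :- con (+ 2) :* θ) :* (θ :+ con (+ 3) :* (t :* t) :* s) :=
             con (+ 4) :* (con (+ 1) :- con (+ 2) :* θ) :* θ :+
             con (+ 4) :* (con (+ 1) :+ con (+ 2) :* (con (+ 1) :- con (+ 3) :* θ)) :* s :* (t :* t))
             refl θ excess recip-denominator ⟩
      fromℕ 4 * (1# - fromℕ 2 * θ) * θ
        + fromℕ 4 * (1# + fromℕ 2 * (1# - fromℕ 3 * θ)) * recip-denominator * (excess * excess)
        ≈⟨ +-congˡ (*-congʳ (*-congʳ (*-congˡ (+-congˡ (*-congˡ (sym excess≈)))))) ⟩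
      fromℕ 4 * (1# - fromℕ 2 * θ) * θ + denominator * recip-denominator * (excess * excess)
        ≈⟨ +-congˡ (*-cong (recip-inverseʳ denominator 0<denominator) (*-cong excess≈ excess≈)) ⟩
      fromℕ 4 * (1# - fromℕ 2 * θ) * θ + 1# * ((1# - fromℕ 3 * θ) * (1# - fromℕ 3 * θ))
        ≈⟨ solve 1 (λ θ →
             con (+ 4) :* (con (+ 1) :- con (+ 2) :* θ) :* θ
               :+ con (+ 1) :* ((con (+ 1) :- con (+ 3) :* θ) :* (con (+ 1) :- con (+ 3) :* θ)) :=
             (con (+ 1) :- θ) :* (con (+ 1) :- θ)) refl θ ⟩
      (1# - θ) * (1# - θ) ∎
      where
      excess≈ : excess ≈ 1# - fromℕ 3 * θ
      excess≈ = x≥0⇒x⊔0≈x (<⇒≤ (θ<⅓⇒0<1-3θ θ<⅓))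

    isL : IsL θ l
    isL = below , ⅓≤θ⇒l≈θ
      where
      below : (θ<⅓ : θ < ⅓) →
              l ≈ ¼ + (θ * θ) * recip (fromℕ 4 * (1# - fromℕ 2 * θ)) (0<4[1-2θ] θ<⅓)
      below θ<⅓ = *-cancelˡ-≈ d 0<d (begin-equality
        d * l                        ≈⟨ θ<⅓⇒4[1-2θ]l θ<⅓ ⟩
        -- The two ones are kept explicit: the first becomes 4 · ¼, the second `d` times its
        -- reciprocal.
        (1# - θ) * (1# - θ)          ≈⟨ solve 1 (λ θ →
          (con (+ 1) :- θ) :* (con (+ 1) :- θ) :=
          con (+ 1) :* (con (+ 1) :- con (+ 2) :* θ) :+ θ :* θ :* con (+ 1)) refl θ ⟩
        1# * (1# - fromℕ 2 * θ) + θ * θ * 1#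
          ≈⟨ +-cong (*-congʳ ¼-inverse) (*-congˡ (recip-inverseʳ d 0<d)) ⟨
        fromℕ 4 * ¼ * (1# - fromℕ 2 * θ) + θ * θ * (d * recip d 0<d)
          ≈⟨ solve 3 (λ θ q s →
               con (+ 4) :* q :* (con (+ 1) :- con (+ 2) :* θ)
                 :+ θ :* θ :* (con (+ 4) :* (con (+ 1) :- con (+ 2) :* θ) :* s) :=
               con (+ 4) :* (con (+ 1) :- con (+ 2) :* θ) :* (q :+ θ :* θ :* s))
               refl θ ¼ (recip d 0<d) ⟩
        d * (¼ + θ * θ * recip d 0<d) ∎)
        where
        d : Carrier
        d = fromℕ 4 * (1# - fromℕ 2 * θ)
        0<d : 0# < d
        0<d = 0<4[1-2θ] θ<⅓

  -- The lower bound f ≥ l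

  r⁺≈imbalance*w : ∀ {θ} (D : WeightedDigraph n) → let open WeightedDigraph D in
                   (0<w : 0# < totalWeight) → imbalance 0<w ≈ θ → r⁺ ≈ θ * totalWeight
  r⁺≈imbalance*w {θ = θ} D 0<w imbalance≈θ = begin-equality
    r⁺                          ≈⟨ *-identityʳ r⁺ ⟨
    r⁺ * 1#                     ≈⟨ *-congˡ (recip-inverseʳ totalWeight 0<w) ⟨
    r⁺ * (totalWeight * w⁻¹)    ≈⟨ solve 3 (λ a b c → a :* (b :* c) := a :* c :* b) refl
                                     r⁺ totalWeight w⁻¹ ⟩
    r⁺ * w⁻¹ * totalWeight      ≈⟨ *-congʳ imbalance≈θ ⟩
    θ * totalWeight             ∎
    where
    open WeightedDigraph D
    w⁻¹ : Carrier
    w⁻¹ = recip totalWeight 0<w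

  l-guaranteed : ∀ θ → θ ≤ 1# → GuaranteedRatio θ (l θ)
  l-guaranteed θ θ≤1 D 0<w imbalance≈θ = ≤-cases θ ⅓ below above
    where
    open WeightedDigraph D

    bound : ∀ α → 0# ≤ α → α ≤ 1# → l θ ≈ α * (1# - α) + α * (fromℕ 2 * α - 1#) * θ →
            l θ * totalWeight ≤ mac D
    bound α 0≤α α≤1 l≈ = begin
      l θ * totalWeight                          ≈⟨ *-congʳ l≈ ⟩
      (κ + ƛ * θ) * totalWeight                  ≈⟨ solve 4 (λ k l θ w → (k :+ l :* θ) :* w := k :* w :+ l :* (θ :* w))
                                                      refl κ ƛ θ totalWeight ⟩
      κ * totalWeight + ƛ * (θ * totalWeight)    ≈⟨ +-congˡ (*-congˡ (r⁺≈imbalance*w D 0<w imbalance≈θ)) ⟨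
      κ * totalWeight + ƛ * r⁺                   ≤⟨ mac-bound ⟩
      mac D                                      ∎
      where open RandomCut D α 0≤α α≤1

    above : ⅓ ≤ θ → l θ * totalWeight ≤ mac D
    -- With α = 1 the cut is deterministic, X being the class of vertices with r > 0; here `κ` = 0
    -- and `ƛ` = 1.
    above ⅓≤θ = bound 1# (<⇒≤ 0<1) (≤-reflexive refl) (trans (⅓≤θ⇒l≈θ θ ⅓≤θ)
      (solve 1 (λ θ → θ := con (+ 1) :* (con (+ 1) :- con (+ 1))
                          :+ con (+ 1) :* (con (+ 2) :* con (+ 1) :- con (+ 1)) :* θ) refl θ))

    -- κ + ƛθ is maximised at α = (1 − θ) / 2(1 − 2θ).
    below : θ < ⅓ → l θ * totalWeight ≤ mac D
    below θ<⅓ = bound α 0≤α α≤1 (*-cancelˡ-≈ (fromℕ 2 * d) (*-pos (0<fromℕ 1) 0<d) (begin-equality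
      fromℕ 2 * d * l θ
        ≈⟨ *-congʳ (solve 1 (λ θ → con (+ 2) :* (con (+ 2) :* (con (+ 1) :- con (+ 2) :* θ)) :=
             con (+ 4) :* (con (+ 1) :- con (+ 2) :* θ)) refl θ) ⟩
      fromℕ 4 * (1# - fromℕ 2 * θ) * l θ
        ≈⟨ θ<⅓⇒4[1-2θ]l θ θ<⅓ ⟩
      (1# - θ) * (1# - θ)
        ≈⟨ solve 1 (λ θ → (con (+ 1) :- θ) :* (con (+ 1) :- θ) :=
             (con (+ 1) :- θ) :* (con (+ 2) :* (con (+ 1) :- θ) :- (con (+ 1) :- θ))) refl θ ⟩
      (1# - θ) * (fromℕ 2 * (1# - θ) - (1# - θ))
        ≈⟨ *-cong dα≈1-θ (+-congˡ (-‿cong dα≈1-θ)) ⟨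
      d * α * (fromℕ 2 * (1# - θ) - d * α)
        ≈⟨ solve 2 (λ θ α → let d = con (+ 2) :* (con (+ 1) :- con (+ 2) :* θ) in
             d :* α :* (con (+ 2) :* (con (+ 1) :- θ) :- d :* α) :=
             con (+ 2) :* d :* (α :* (con (+ 1) :- α) :+ α :* (con (+ 2) :* α :- con (+ 1)) :* θ))
             refl θ α ⟩
      fromℕ 2 * d * (α * (1# - α) + α * (fromℕ 2 * α - 1#) * θ) ∎))
      where
      d : Carrier
      d = fromℕ 2 * (1# - fromℕ 2 * θ)

      0<d : 0# < d
      0<d = <-≤-trans (θ<⅓⇒0<1-3θ θ<⅓) (≤-by-difference
        (solve 1 (λ θ → con (+ 2) :* (con (+ 1) :- con (+ 2) :* θ) :- (con (+ 1) :- con (+ 3) :* θ)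
                        := con (+ 1) :- θ) refl θ) (x≤y⇒0≤y-x θ≤1))

      α : Carrier
      α = (1# - θ) * recip d 0<d

      dα≈1-θ : d * α ≈ 1# - θ
      dα≈1-θ = begin-equality
        d * ((1# - θ) * recip d 0<d)  ≈⟨ solve 3 (λ a b c → a :* (b :* c) := b :* (a :* c)) refl d (1# - θ) _ ⟩
        (1# - θ) * (d * recip d 0<d)  ≈⟨ *-congˡ (recip-inverseʳ d 0<d) ⟩
        (1# - θ) * 1#                 ≈⟨ *-identityʳ _ ⟩
        1# - θ                        ∎

      0≤α : 0# ≤ α
      0≤α = 0≤* (x≤y⇒0≤y-x θ≤1) (<⇒≤ (0<recip d 0<d))

      α≤1 : α ≤ 1#
      -- The condition amounts to 1 - θ ≤ 2(1 - 2θ), that is θ ≤ 1/3: the threshold is where the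
      -- optimal probability reaches 1.
      α≤1 = *-cancelˡ-≤ d 0<d (begin
        d * α    ≈⟨ dα≈1-θ ⟩
        1# - θ   ≤⟨ ≤-by-difference (solve 1 (λ θ →
                      con (+ 2) :* (con (+ 1) :- con (+ 2) :* θ) :* con (+ 1) :- (con (+ 1) :- θ) :=
                      con (+ 1) :- con (+ 3) :* θ) refl θ) (<⇒≤ (θ<⅓⇒0<1-3θ θ<⅓)) ⟩
        d * 1#   ∎)

  -- Extremal digraphs

  -- In each case the slack is an explicit sum of nonnegative terms. They vanish at the maximiser: s
  -- = t = K above the threshold, s = t = (1 - θ)K / 2(1 - 2θ) below it.
  quadratic-bound : ∀ θ → 0# ≤ θ → θ ≤ 1# → ∀ K s t →
    0# ≤ s → 0# ≤ K - s → 0# ≤ t → 0# ≤ K - t →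
    (1# - θ) * (s * (K - s) + t * (K - t)) + fromℕ 2 * θ * (s * t) ≤ fromℕ 2 * (K * K) * l θ
  quadratic-bound θ 0≤θ θ≤1 K s t 0≤s 0≤K-s 0≤t 0≤K-t = ≤-cases θ ⅓ below above
    where
    Q : Carrier
    Q = (1# - θ) * (s * (K - s) + t * (K - t)) + fromℕ 2 * θ * (s * t)

    0≤1-θ : 0# ≤ 1# - θ
    0≤1-θ = x≤y⇒0≤y-x θ≤1

    above : ⅓ ≤ θ → Q ≤ fromℕ 2 * (K * K) * l θ
    above ⅓≤θ = begin
      Q                        ≤⟨ ≤-by-difference
        (solve 4 (λ θ K s t →
          con (+ 2) :* (K :* K) :* θ
            :- ((con (+ 1) :- θ) :* (s :* (K :- s) :+ t :* (K :- t)) :+ con (+ 2) :* θ :* (s :* t)) :=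
          (con (+ 3) :* θ :- con (+ 1)) :* ((K :- s) :* t :+ (K :- t) :* s)
            :+ (con (+ 1) :- θ) :* ((s :- t) :* (s :- t))
            :+ con (+ 2) :* θ :* ((K :- s) :* (K :- t))) refl θ K s t)
        (0≤+ (0≤+ (0≤* (⅓≤θ⇒0≤3θ-1 ⅓≤θ) (0≤+ (0≤* 0≤K-s 0≤t) (0≤* 0≤K-t 0≤s)))
                  (0≤* 0≤1-θ (0≤x*x (s - t))))
             (0≤* (0≤* (0≤fromℕ 2) 0≤θ) (0≤* 0≤K-s 0≤K-t))) ⟩
      fromℕ 2 * (K * K) * θ    ≈⟨ *-congˡ (⅓≤θ⇒l≈θ θ ⅓≤θ) ⟨
      fromℕ 2 * (K * K) * l θ  ∎

    below : θ < ⅓ → Q ≤ fromℕ 2 * (K * K) * l θ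
    below θ<⅓ = *-cancelˡ-≤ (fromℕ 4 * d) (0<4[1-2θ] θ<⅓) (begin
      fromℕ 4 * d * Q
        ≤⟨ ≤-by-difference
          (solve 4 (λ θ K s t → let d = con (+ 1) :- con (+ 2) :* θ
                                    e = (con (+ 1) :- θ) :* K :- d :* (s :+ t) in
            con (+ 2) :* (K :* K) :* ((con (+ 1) :- θ) :* (con (+ 1) :- θ)) :-
            con (+ 4) :* d :* ((con (+ 1) :- θ) :* (s :* (K :- s) :+ t :* (K :- t)) :+ con (+ 2) :* θ :* (s :* t)) :=
            con (+ 2) :* (e :* e :+ d :* ((s :- t) :* (s :- t)))) refl θ K s t)
          (0≤* (0≤fromℕ 2) (0≤+ (0≤x*x _) (0≤* 0≤d (0≤x*x _)))) ⟩
      fromℕ 2 * (K * K) * ((1# - θ) * (1# - θ))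
        ≈⟨ *-congˡ (θ<⅓⇒4[1-2θ]l θ θ<⅓) ⟨
      fromℕ 2 * (K * K) * (fromℕ 4 * d * l θ)
        ≈⟨ solve 3 (λ a b c → a :* (b :* c) := b :* (a :* c)) refl (fromℕ 2 * (K * K)) (fromℕ 4 * d) (l θ) ⟩
      fromℕ 4 * d * (fromℕ 2 * (K * K) * l θ) ∎)
      where
      d : Carrier
      d = 1# - fromℕ 2 * θ
      0≤d : 0# ≤ d
      0≤d = *-cancelˡ-≤ (fromℕ 4) (0<fromℕ 3)
        (≤-trans (≤-reflexive (zeroʳ (fromℕ 4))) (<⇒≤ (0<4[1-2θ] θ<⅓)))

  -- The two classes alternate, so recursion on `k` removes one vertex of each, matching how
  -- `suc k ℕ.* 2` computes.
  colour : ∀ k → Fin (k ℕ.* 2) → Bool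
  colour (suc k) zero          = true
  colour (suc k) (suc zero)    = false
  colour (suc k) (suc (suc v)) = colour k v

  sum-colour : ∀ k (f : Bool → Carrier) → (sum λ v → f (colour k v)) ≈ fromℕ k * (f true + f false)
  sum-colour zero    f = sym (zeroˡ _)
  sum-colour (suc k) f = trans (+-congˡ (+-congˡ (sum-colour k f)))
    (solve 3 (λ k x y → x :+ (y :+ k :* (x :+ y)) := (con (+ 1) :+ k) :* (x :+ y)) refl
       (fromℕ k) (f true) (f false))

  module Extremal (θ : Carrier) (0≤θ : 0# ≤ θ) (θ≤1 : θ ≤ 1#) (m : ℕ) where

    -- The offset 2 gives M ≥ 1, hence positive total weight, and makes K equal to 1 + M by
    -- computation, as the calls of the solver require.
    k : ℕ
    k = suc (suc m)

    -- A class has KM arcs inside and K² arcs lead across, so the factors K in `a` and M in `b` give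
    -- all contributions the common factor K²M: 2(1 - θ)K²M inside the classes and 2θK²M across.
    K M a b : Carrier
    K = fromℕ k
    M = fromℕ (suc m)
    a = (1# - θ) * K
    b = fromℕ 2 * θ * M

    0≤a : 0# ≤ a
    0≤a = 0≤* (x≤y⇒0≤y-x θ≤1) (0≤fromℕ k)

    0≤b : 0# ≤ b
    0≤b = 0≤* (0≤* (0≤fromℕ 2) 0≤θ) (0≤fromℕ (suc m))

    class-weight : Bool → Bool → Carrier
    class-weight true  true  = a
    class-weight true  false = b
    class-weight false true  = 0#
    class-weight false false = a

    0≤class-weight : ∀ i j → 0# ≤ class-weight i j
    0≤class-weight true  true  = 0≤a
    0≤class-weight true  false = 0≤b
    0≤class-weight false true  = ≤-reflexive refl
    0≤class-weight false false = 0≤a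

    -- Loops are included here, so that the weight depends on the colours alone and `sum-colour`
    -- applies.
    weight : Fin (k ℕ.* 2) → Fin (k ℕ.* 2) → Carrier
    weight u v = class-weight (colour k u) (colour k v)

    arc′ : Fin (k ℕ.* 2) → Fin (k ℕ.* 2) → Maybe Carrier
    arc′ u v with u ≟ v
    ... | yes _ = nothing
    ... | no  _ = just (weight u v)

    D : WeightedDigraph (k ℕ.* 2)
    D = record { arc = arc′ ; loopless = loopless′ ; nonNegative = nonNegative′ }
      where
      loopless′ : ∀ v → arc′ v v ≡ nothing
      loopless′ v with v ≟ v
      ... | yes _  = ≡.refl
      ... | no v≢v = ⊥-elim (v≢v ≡.refl)

      nonNegative′ : ∀ u v → All.All (0# ≤_) (arc′ u v)
      nonNegative′ u v with u ≟ v
      ... | yes _ = All.nothing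
      ... | no  _ = All.just (0≤class-weight (colour k u) (colour k v))

    open WeightedDigraph D

    arcWeight-loop : ∀ v → arcWeight v v ≈ 0#
    arcWeight-loop v = reflexive (≡.cong (fromMaybe 0#) (loopless v))

    arcWeight-≢ : ∀ {u v} → u ≢ v → arcWeight u v ≈ weight u v
    arcWeight-≢ {u} {v} u≢v with u ≟ v
    ... | yes u≡v = ⊥-elim (u≢v u≡v)
    ... | no  _   = refl

    weight-loop : ∀ v → weight v v ≈ a
    weight-loop v with colour k v
    ... | true  = refl
    ... | false = refl

    outWeight≈ : ∀ u → outWeight u ≈
      K * (class-weight (colour k u) true + class-weight (colour k u) false) - a
    outWeight≈ u = begin-equality
      outWeight u
        ≈⟨ sum-change-one (arcWeight u) (weight u) u (λ _ → arcWeight-≢) ⟩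
      sum (weight u) + (arcWeight u u - weight u u)
        ≈⟨ +-cong (sum-colour k (class-weight (colour k u)))
                  (+-cong (arcWeight-loop u) (-‿cong (weight-loop u))) ⟩
      _ + (0# - a)
        ≈⟨ +-congˡ (+-identityˡ (- a)) ⟩
      _ - a ∎

    inWeight≈ : ∀ v → inWeight v ≈
      K * (class-weight true (colour k v) + class-weight false (colour k v)) - a
    inWeight≈ v = begin-equality
      inWeight v
        ≈⟨ sum-change-one (λ u → arcWeight u v) (λ u → weight u v) v
             (λ _ v≢u → arcWeight-≢ (v≢u ∘ ≡.sym)) ⟩
      (sum λ u → weight u v) + (arcWeight v v - weight v v)
        ≈⟨ +-cong (sum-colour k (λ c → class-weight c (colour k v)))
                  (+-cong (arcWeight-loop v) (-‿cong (weight-loop v))) ⟩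
      _ + (0# - a)
        ≈⟨ +-congˡ (+-identityˡ (- a)) ⟩
      _ - a ∎

    totalWeight≈ : totalWeight ≈ fromℕ 2 * (K * K) * M
    totalWeight≈ = begin-equality
      totalWeight
        ≈⟨ sum-cong-≋ outWeight≈ ⟩
      (sum λ u → K * (class-weight (colour k u) true + class-weight (colour k u) false) - a)
        ≈⟨ sum-colour k (λ c → K * (class-weight c true + class-weight c false) - a) ⟩
      K * ((K * (a + b) - a) + (K * (0# + a) - a))
        ≈⟨ solve 2 (λ θ M → let K = con (+ 1) :+ M
                                a = (con (+ 1) :- θ) :* K
                                b = con (+ 2) :* θ :* M in
             K :* ((K :* (a :+ b) :- a) :+ (K :* (con (+ 0) :+ a) :- a)) :=
             con (+ 2) :* (K :* K) :* M) refl θ M ⟩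
      fromℕ 2 * (K * K) * M ∎

    0<totalWeight : 0# < totalWeight
    0<totalWeight = <-≤-trans
      (*-pos (*-pos (0<fromℕ 1) (*-pos (0<fromℕ (suc m)) (0<fromℕ (suc m)))) (0<fromℕ m))
      (≤-reflexive (sym totalWeight≈))

    -- Arcs inside a class cancel in `r`, leaving Kb on the first class and -Kb on the second. The
    -- two equations are abstracted together with the colour so that the class weights compute in
    -- each branch.
    r⊔0≈ : ∀ v → r v ⊔ 0# ≈ K * b * χ (colour k v)
    r⊔0≈ v with colour k v | outWeight≈ v | inWeight≈ v
    ... | true | out≈ | in≈ = begin-equality
      r v ⊔ 0#      ≈⟨ x≥0⇒x⊔0≈x (≤-trans 0≤Kb (≤-reflexive (sym r≈))) ⟩
      r v           ≈⟨ r≈ ⟩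
      K * b         ≈⟨ *-identityʳ (K * b) ⟨
      K * b * 1#    ∎
      where
      0≤Kb : 0# ≤ K * b
      0≤Kb = 0≤* (0≤fromℕ k) 0≤b
      r≈ : r v ≈ K * b
      r≈ = trans (+-cong out≈ (-‿cong in≈))
        (solve 3 (λ K a b → K :* (a :+ b) :- a :- (K :* (a :+ con (+ 0)) :- a) := K :* b) refl K a b)
    ... | false | out≈ | in≈ = trans (x≤0⇒x⊔0≈0 (≤-by-difference
      (trans (+-congˡ (-‿cong (+-cong out≈ (-‿cong in≈))))
        (solve 3 (λ K a b → con (+ 0) :- (K :* (con (+ 0) :+ a) :- a :- (K :* (b :+ a) :- a)) := K :* b)
           refl K a b))
      (0≤* (0≤fromℕ k) 0≤b))) (sym (zeroʳ _))

    imbalance≈θ : imbalance 0<totalWeight ≈ θ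
    imbalance≈θ = begin-equality
      r⁺ * w⁻¹
        ≈⟨ *-congʳ (trans (sum-cong-≋ r⊔0≈) (sum-colour k (λ c → K * b * χ c))) ⟩
      K * (K * b * 1# + K * b * 0#) * w⁻¹
        ≈⟨ solve 4 (λ θ K M w → K :* (K :* (con (+ 2) :* θ :* M) :* con (+ 1) :+ K :* (con (+ 2) :* θ :* M) :* con (+ 0)) :* w
             := θ :* (con (+ 2) :* (K :* K) :* M :* w)) refl θ K M w⁻¹ ⟩
      θ * (fromℕ 2 * (K * K) * M * w⁻¹)
        ≈⟨ *-congˡ (*-congʳ totalWeight≈) ⟨
      θ * (totalWeight * w⁻¹)
        ≈⟨ *-congˡ (recip-inverseʳ totalWeight 0<totalWeight) ⟩
      θ * 1#
        ≈⟨ *-identityʳ θ ⟩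
      θ ∎
      where
      w⁻¹ : Carrier
      w⁻¹ = recip totalWeight 0<totalWeight

    class-weight≈ : ∀ i j → class-weight i j ≈
      a * (χ i * χ j) + a * (χ (not i) * χ (not j)) + b * (χ i * χ (not j))
    class-weight≈ true  true  = solve 2 (λ a b → a :=
      a :* (con (+ 1) :* con (+ 1)) :+ a :* (con (+ 0) :* con (+ 0)) :+ b :* (con (+ 1) :* con (+ 0))) refl a b
    class-weight≈ true  false = solve 2 (λ a b → b :=
      a :* (con (+ 1) :* con (+ 0)) :+ a :* (con (+ 0) :* con (+ 1)) :+ b :* (con (+ 1) :* con (+ 1))) refl a b
    class-weight≈ false true  = solve 2 (λ a b → con (+ 0) :=
      a :* (con (+ 0) :* con (+ 1)) :+ a :* (con (+ 1) :* con (+ 0)) :+ b :* (con (+ 0) :* con (+ 0))) refl a b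
    class-weight≈ false false = solve 2 (λ a b → a :=
      a :* (con (+ 0) :* con (+ 0)) :+ a :* (con (+ 1) :* con (+ 1)) :+ b :* (con (+ 0) :* con (+ 1))) refl a b

    -- S and T̄ are the numbers of vertices of X in the two classes, S̄ and T those of the
    -- vertices outside X.
    module _ (X : Subset (k ℕ.* 2)) where

      count : (Bool → Bool) → (Bool → Bool) → Carrier
      count f g = sum λ v → χ (f (lookup X v)) * χ (g (colour k v))

      S S̄ T̄ T : Carrier
      S = count id id
      S̄ = count not id
      T̄ = count id not
      T = count not not

      0≤χ : ∀ x → 0# ≤ χ x
      0≤χ true  = <⇒≤ 0<1
      0≤χ false = ≤-reflexive refl

      0≤count : ∀ f g → 0# ≤ count f g
      0≤count f g = 0≤sum λ v → 0≤* (0≤χ (f (lookup X v))) (0≤χ (g (colour k v)))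

      χ-not : ∀ x → χ x + χ (not x) ≈ 1#
      χ-not true  = +-identityʳ 1#
      χ-not false = +-identityˡ 1#

      count-complement : ∀ g → count id g + count not g ≈ K * (χ (g true) + χ (g false))
      count-complement g = begin-equality
        count id g + count not g
          ≈⟨ ∑-distrib-+ (λ v → χ (lookup X v) * χ (g (colour k v))) (λ v → χ (not (lookup X v)) * χ (g (colour k v))) ⟨
        (sum λ v → χ (lookup X v) * χ (g (colour k v)) + χ (not (lookup X v)) * χ (g (colour k v)))
          ≈⟨ sum-cong-≋ (λ v → trans (sym (distribʳ (χ (g (colour k v))) (χ (lookup X v)) (χ (not (lookup X v)))))
               (trans (*-congʳ (χ-not (lookup X v))) (*-identityˡ _))) ⟩
        (sum λ v → χ (g (colour k v)))
          ≈⟨ sum-colour k (χ ∘ g) ⟩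
        K * (χ (g true) + χ (g false)) ∎

      S̄≈K-S : S̄ ≈ K - S
      S̄≈K-S = begin-equality
        S̄          ≈⟨ solve 2 (λ x y → y := x :+ y :- x) refl S S̄ ⟩
        S + S̄ - S  ≈⟨ +-congʳ (trans (count-complement id) (trans (*-congˡ (+-identityʳ 1#)) (*-identityʳ K))) ⟩
        K - S      ∎

      T̄≈K-T : T̄ ≈ K - T
      T̄≈K-T = begin-equality
        T̄          ≈⟨ solve 2 (λ x y → x := x :+ y :- y) refl T̄ T ⟩
        T̄ + T - T  ≈⟨ +-congʳ (trans (count-complement not) (trans (*-congˡ (+-identityˡ 1#)) (*-identityʳ K))) ⟩
        K - T      ∎

      -- Separates the data of the tail from those of the head, so that the double sum over arcs
      -- factors into products of counts.
      class-term : ∀ x y i j →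
        (if x ∧ not y then class-weight i j else 0#) ≈
        a * ((χ x * χ i) * (χ (not y) * χ j)) + a * ((χ x * χ (not i)) * (χ (not y) * χ (not j)))
          + b * ((χ x * χ i) * (χ (not y) * χ (not j)))
      class-term false y     i j = solve 6 (λ a b p q r s →
        con (+ 0) := a :* ((con (+ 0) :* p) :* r) :+ a :* ((con (+ 0) :* q) :* s)
                       :+ b :* ((con (+ 0) :* p) :* s))
        refl a b (χ i) (χ (not i)) (χ (not y) * χ j) (χ (not y) * χ (not j))
      class-term true  true  i j = solve 6 (λ a b p q r s →
        con (+ 0) := a :* (p :* (con (+ 0) :* r)) :+ a :* (q :* (con (+ 0) :* s))
                       :+ b :* (p :* (con (+ 0) :* s)))
        refl a b (1# * χ i) (1# * χ (not i)) (χ j) (χ (not j))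
      class-term true  false i j = trans (class-weight≈ i j) (solve 6 (λ a b p q r s →
        a :* (p :* r) :+ a :* (q :* s) :+ b :* (p :* s) :=
        a :* ((con (+ 1) :* p) :* (con (+ 1) :* r)) :+ a :* ((con (+ 1) :* q) :* (con (+ 1) :* s))
          :+ b :* ((con (+ 1) :* p) :* (con (+ 1) :* s)))
        refl a b (χ i) (χ (not i)) (χ j) (χ (not j)))

      -- A loop never crosses a cut, so the diagonal of `weight` does no harm here.
      cut-term : ∀ u v →
        (if lookup X u ∧ not (lookup X v) then arcWeight u v else 0#) ≈
        (if lookup X u ∧ not (lookup X v) then weight u v else 0#)
      cut-term u v with u ≟ v
      ... | no _ = refl
      ... | yes ≡.refl with lookup X u
      ...   | true  = refl
      ...   | false = refl

      sum₂-scaled : ∀ z (f g : Fin (k ℕ.* 2) → Carrier) →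
                    (sum λ u → sum λ v → z * (f u * g v)) ≈ z * (sum f * sum g)
      sum₂-scaled z f g = trans
        (sum-cong-≋ λ u → sym (*-distribˡ-sum z (λ v → f u * g v)))
        (trans (sym (*-distribˡ-sum z (λ u → sum λ v → f u * g v))) (*-congˡ (sum-product f g)))

      cutWeight≈ : cutWeight X ≈ a * (S * S̄) + a * (T̄ * T) + b * (S * T)
      cutWeight≈ = begin-equality
        cutWeight X
          ≈⟨ sum-cong₂ (λ u v → trans (cut-term u v)
               (class-term (lookup X u) (lookup X v) (colour k u) (colour k v))) ⟩
        (sum λ u → sum λ v → f₁ u v + f₂ u v + f₃ u v)
          ≈⟨ sum₂-+ (λ u v → f₁ u v + f₂ u v) f₃ ⟩
        (sum λ u → sum λ v → f₁ u v + f₂ u v) + (sum λ u → sum (f₃ u))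
          ≈⟨ +-congʳ (sum₂-+ f₁ f₂) ⟩
        (sum λ u → sum (f₁ u)) + (sum λ u → sum (f₂ u)) + (sum λ u → sum (f₃ u))
          ≈⟨ +-cong (+-cong (sum₂-scaled a (in-X id) (out-X id)) (sum₂-scaled a (in-X not) (out-X not)))
                    (sum₂-scaled b (in-X id) (out-X not)) ⟩
        a * (S * S̄) + a * (T̄ * T) + b * (S * T) ∎
        where
        in-X out-X : (Bool → Bool) → Fin (k ℕ.* 2) → Carrier
        in-X  g v = χ (lookup X v) * χ (g (colour k v))
        out-X g v = χ (not (lookup X v)) * χ (g (colour k v))

        f₁ f₂ f₃ : Fin (k ℕ.* 2) → Fin (k ℕ.* 2) → Carrier
        f₁ u v = a * (in-X id u * out-X id v)
        f₂ u v = a * (in-X not u * out-X not v)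
        f₃ u v = b * (in-X id u * out-X not v)

        sum₂-+ : (f g : Fin (k ℕ.* 2) → Fin (k ℕ.* 2) → Carrier) →
          (sum λ u → sum λ v → f u v + g u v) ≈ (sum λ u → sum (f u)) + (sum λ u → sum (g u))
        sum₂-+ f g = trans (sum-cong-≋ λ u → ∑-distrib-+ (f u) (g u))
                           (∑-distrib-+ (λ u → sum (f u)) (λ u → sum (g u)))

      -- The quadratic bound accounts for M / K of the weight a, and the term 1 for the rest.
      cutWeight-bound : cutWeight X ≤ fromℕ 2 * (K * K) * (M * l θ + 1#)
      cutWeight-bound = begin
        cutWeight X
          ≈⟨ cutWeight≈ ⟩
        a * (S * S̄) + a * (T̄ * T) + b * (S * T)
          ≈⟨ +-congʳ (+-cong (*-congˡ (*-congˡ S̄≈K-S)) (*-congˡ (*-congʳ T̄≈K-T))) ⟩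
        a * (S * (K - S)) + a * ((K - T) * T) + b * (S * T)
          ≈⟨ solve 4 (λ θ M S T → let K = con (+ 1) :+ M
                                      P = S :* (K :- S) :+ T :* (K :- T)
                                      a = (con (+ 1) :- θ) :* K in
               a :* (S :* (K :- S)) :+ a :* ((K :- T) :* T) :+ con (+ 2) :* θ :* M :* (S :* T) :=
               M :* ((con (+ 1) :- θ) :* P :+ con (+ 2) :* θ :* (S :* T)) :+ (con (+ 1) :- θ) :* P)
               refl θ M S T ⟩
        M * ((1# - θ) * (S * (K - S) + T * (K - T)) + fromℕ 2 * θ * (S * T))
          + (1# - θ) * (S * (K - S) + T * (K - T))
          ≤⟨ +-mono-≤
               (*-monoˡ-≤ M (0≤fromℕ (suc m)) (quadratic-bound θ 0≤θ θ≤1 K S T 0≤S 0≤K-S 0≤T 0≤K-T))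
               -- Each of S(K - S) and T(K - T) is at most K², because K² - S(K - S) = K(K - S) +
               -- S².
               (≤-by-difference
                 (solve 4 (λ θ K S T → let P = S :* (K :- S) :+ T :* (K :- T) in
                   con (+ 2) :* (K :* K) :- (con (+ 1) :- θ) :* P :=
                   θ :* P :+ (K :* (K :- S) :+ S :* S :+ (K :* (K :- T) :+ T :* T)))
                   refl θ K S T)
                 (0≤+ (0≤* 0≤θ (0≤+ (0≤* 0≤S 0≤K-S) (0≤* 0≤T 0≤K-T)))
                      (0≤+ (0≤+ (0≤* (0≤fromℕ k) 0≤K-S) (0≤x*x S))
                           (0≤+ (0≤* (0≤fromℕ k) 0≤K-T) (0≤x*x T))))) ⟩
        M * (fromℕ 2 * (K * K) * l θ) + fromℕ 2 * (K * K)
          ≈⟨ solve 3 (λ M c l → M :* (c :* l) :+ c := c :* (M :* l :+ con (+ 1))) refl M (fromℕ 2 * (K * K)) (l θ) ⟩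
        fromℕ 2 * (K * K) * (M * l θ + 1#) ∎
        where
        0≤S : 0# ≤ S
        0≤S = 0≤count id id
        0≤T : 0# ≤ T
        0≤T = 0≤count not not
        0≤K-S : 0# ≤ K - S
        0≤K-S = ≤-trans (0≤count not id) (≤-reflexive S̄≈K-S)
        0≤K-T : 0# ≤ K - T
        0≤K-T = ≤-trans (0≤count id not) (≤-reflexive T̄≈K-T)

    -- Testing `g` on this digraph gives g ≤ l(θ) + 1/M, stated without division.
    guaranteed-bound : ∀ g → GuaranteedRatio θ g → M * g ≤ M * l θ + 1#
    guaranteed-bound g guaranteed = *-cancelˡ-≤ (fromℕ 2 * (K * K))
      (*-pos (0<fromℕ 1) (*-pos (0<fromℕ (suc m)) (0<fromℕ (suc m)))) (begin
        fromℕ 2 * (K * K) * (M * g)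
          ≈⟨ solve 3 (λ c M g → c :* (M :* g) := g :* (c :* M)) refl (fromℕ 2 * (K * K)) M g ⟩
        g * (fromℕ 2 * (K * K) * M)
          ≈⟨ *-congˡ totalWeight≈ ⟨
        g * totalWeight
          ≤⟨ guaranteed D 0<totalWeight imbalance≈θ ⟩
        mac D
          ≤⟨ maxOverSubsets-least (k ℕ.* 2) cutWeight-bound ⟩
        fromℕ 2 * (K * K) * (M * l θ + 1#) ∎)

  -- The error 1/M tends to 0: if g exceeded l(θ) by δ, the Archimedean property would give M > 1/δ,
  -- against `guaranteed-bound`.
  l-upperBound : ∀ θ → 0# ≤ θ → θ ≤ 1# → ∀ g → GuaranteedRatio θ g → g ≤ l θ
  l-upperBound θ 0≤θ θ≤1 g guaranteed l<g =
    Extremal.guaranteed-bound θ 0≤θ θ≤1 m g guaranteed (begin-strict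
      M * l θ + 1#            ≈⟨ +-congˡ (recip-inverseʳ δ 0<δ) ⟨
      M * l θ + δ * δ⁻¹       ≈⟨ +-comm _ _ ⟩
      δ * δ⁻¹ + M * l θ       ≈⟨ +-identityˡ _ ⟨
      0# + (δ * δ⁻¹ + M * l θ)
        <⟨ +-monoˡ-< _ (*-pos 0<δ (x<y⇒0<y-x δ⁻¹<M)) ⟩
      δ * (M - δ⁻¹) + (δ * δ⁻¹ + M * l θ)
        ≈⟨ solve 4 (λ g l M i → (g :- l) :* (M :- i) :+ ((g :- l) :* i :+ M :* l) := M :* g)
             refl g (l θ) M δ⁻¹ ⟩
      M * g                   ∎)
    where
    δ : Carrier
    δ = g - l θ
    0<δ : 0# < δ
    0<δ = x<y⇒0<y-x l<g
    δ⁻¹ : Carrier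
    δ⁻¹ = recip δ 0<δ
    m : ℕ
    m = proj₁ (archimedean δ⁻¹)
    M : Carrier
    M = fromℕ (suc m)
    δ⁻¹<M : δ⁻¹ < M
    δ⁻¹<M = begin-strict
      δ⁻¹             <⟨ proj₂ (archimedean δ⁻¹) ⟩
      fromℕ m         ≈⟨ +-identityˡ (fromℕ m) ⟨
      0# + fromℕ m    <⟨ +-monoˡ-< (fromℕ m) 0<1 ⟩
      1# + fromℕ m    ∎

mainTheorem9 : {c ℓ₁ ℓ₂ : Level} (ℝ : RealNumbers c ℓ₁ ℓ₂) →
    let open Real ℝ in
    (θ : Carrier) → 0# ≤ θ → θ ≤ 1# →
    ∃ λ y → IsF θ y × IsL θ y
mainTheorem9 ℝ θ 0≤θ θ≤1 =
  -- The supremum is attained: `l θ` is itself a guaranteed ratio, so every upper bound is at least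
  -- `l θ`.
  l θ , (l-upperBound θ 0≤θ θ≤1 , λ _ isUpperBound → isUpperBound (l θ) (l-guaranteed θ θ≤1)) , isL θ
  where open MaxCut ℝ
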